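{- For every natural number $n \geq 2$, there exists a regular graph $G_n$ with $\chi(G_n) = n$ and $\chi_2(G_n) = 2\chi(G_n)$.
   Context: All graphs are finite and simple. A proper $k$-colouring of a graph $G$ is a map $c\colon V(G)\to[k]$ with $c(u)\neq c(v)$ for every edge $uv$; $\chi(G)$ is the chromatic number. For an integer $r\ge 1$, an $r$-dynamic $k$-colouring of $G$ is a proper $k$-colouring $c$ such that for every vertex $v$, the set $c(N(v))$ of colours used on the neighbourhood $N(v)$ has size at least $\min\{r, d(v)\}$, where $d(v)$ is the degree of $v$. The $r$-dynamic chromatic number $\chi_r(G)$ is the least $k$ such that $G$ has an $r$-dynamic $k$-colouring. In particular $\chi_2(G)$ (the dynamic chromatic number) is the least number of colours in a proper colouring in which the neighbourhood of every vertex of degree at least $2$ is not monochromatic. -}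

module Defs where

open import Data.Fin.Base using (Fin)
open import Data.Fin.Properties using (_≟_; any?)
open import Data.Fin.Subset using (Subset; ∣_∣)
open import Data.Fin.Subset.Properties using (_∈?_)
open import Data.Nat.Base using (ℕ; _≤_; _⊓_)
open import Data.Product.Base using (∃; _×_)
open import Data.Vec.Base using (tabulate)
open import Relation.Binary.Core using (Rel)
open import Relation.Binary.Definitions using (Decidable; Irreflexive; Symmetric)
open import Relation.Binary.PropositionalEquality.Core using (_≡_; _≢_)
open import Relation.Nullary.Decidable using (does; _×-dec_)
open import Level using (0ℓ)

record Graph : Set₁ where
  infix 4 _~_ _~?_
  field
    order    : ℕ
  Vertex : Set
  Vertex = Fin order
  field
    _~_      : Rel Vertex 0ℓ
    _~?_     : Decidable _~_
    ~-sym    : Symmetric _~_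
    ~-irrefl : Irreflexive _≡_ _~_

  neighbourhood : Vertex → Subset order
  neighbourhood v = tabulate (λ u → does (v ~? u))

  degree : Vertex → ℕ
  degree v = ∣ neighbourhood v ∣

image : ∀ {m k} → (Fin m → Fin k) → Subset m → Subset k
image c p = tabulate (λ a → does (any? (λ u → (u ∈? p) ×-dec (c u ≟ a))))

Regular : Graph → Set
Regular G = ∃ λ d → ∀ v → degree v ≡ d
  where open Graph G

Colouring : Graph → ℕ → Set
Colouring G k = Graph.Vertex G → Fin k

IsProper : ∀ G {k} → Colouring G k → Set
IsProper G c = ∀ {u v} → u ~ v → c u ≢ c v
  where open Graph G

IsDynamic : ℕ → ∀ G {k} → Colouring G k → Set
IsDynamic r G c =
  IsProper G c × (∀ v → r ⊓ degree v ≤ ∣ image c (neighbourhood v) ∣)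
  where open Graph G

Colourable : Graph → ℕ → Set
Colourable G k = ∃ λ (c : Colouring G k) → IsProper G c

DynamicColourable : ℕ → Graph → ℕ → Set
DynamicColourable r G k = ∃ λ (c : Colouring G k) → IsDynamic r G c

IsLeast : (ℕ → Set) → ℕ → Set
IsLeast P k = P k × (∀ j → P j → k ≤ j)

-- The chromatic numbers are rendered as relations:
-- HasChromaticNumber G k reads "χ(G) = k", and
-- HasDynamicChromaticNumber r G k reads "χ_r(G) = k".

HasChromaticNumber : Graph → ℕ → Set
HasChromaticNumber G = IsLeast (Colourable G)

HasDynamicChromaticNumber : ℕ → Graph → ℕ → Set
HasDynamicChromaticNumber r G = IsLeast (DynamicColourable r G)

{-# OPTIONS --safe #-}

-- Take many disjoint copies of the complete n-partite graph with parts of size m.  For every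
-- n-subset S of the copies and every part index i add a probe vertex joined to the i-th part of
-- each copy in S.  With m the number of such S containing a given copy the graph is nm-regular,
-- and it is n-colourable because a probe sees a single part index.  Colouring the parts with
-- disjoint pairs of colours gives a dynamic 2n-colouring.  With fewer than 2n colours every copy
-- has a monochromatic part; by the pigeonhole principle n copies have one with the same index
-- and colour, and the probe of these n copies has a monochromatic neighbourhood.

module Submission where

open import Defs
open import Data.Bool.Base using (Bool; true; false; _∧_; not; if_then_else_)
open import Data.Bool.Properties using (∧-identityʳ)
open import Data.Empty as Empty using ()
open import Data.Fin.Base
  using (Fin; zero; suc; _↑ˡ_; _↑ʳ_; splitAt; quotRem; remQuot; quotient; combine)
open import Data.Fin.Properties
  using (_≟_; any?; all?; ¬∀⟶∃¬; injective⇒≤; splitAt-↑ˡ; splitAt-↑ʳ; combine-injective;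
         combine-injectiveˡ; combine-injectiveʳ; combine-remQuot; +↔⊎; *↔×)
open import Data.Fin.Subset using (Subset; inside; outside; ⊥; ⁅_⁆; ∣_∣; _∈_; _⊆_)
open import Data.Fin.Subset.Properties
  using (_∈?_; ∉⊥; ∣⊥∣≡0; ∣⁅x⁆∣≡1; x∈⁅x⁆; p⊆q⇒∣p∣≤∣q∣; x∈p⇒∣p-x∣<∣p∣; x∈p∧x≢y⇒x∈p-y; s⊆s;
         nonempty?; Empty-unique)
open import Data.Nat.Base
  using (ℕ; zero; suc; _+_; _*_; _∸_; _⊓_; _≤_; _<_; _≥_; z≤n; s≤s; s≤s⁻¹)
open import Data.Nat.Properties
  using (+-0-commutativeMonoid; +-comm; +-identityʳ; +-mono-≤; *-identityˡ; *-monoˡ-≤; *-monoʳ-≤;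
         ≤-trans; <⇒≤; ≤⇒≯; ≮⇒≥; _<?_; m⊓n≤m; m+[n∸m]≡n; m≤m+n; m≤n*m)
open import Data.Product.Base as Product using (∃; ∃₂; _×_; _,_; proj₁; proj₂; uncurry)
open import Data.Product.Function.NonDependent.Propositional using (_×-↔_)
open import Data.Sum.Base as Sum using (_⊎_; inj₁; inj₂; [_,_]′)
open import Data.Sum.Function.Propositional using (_⊎-↔_)
open import Data.Vec.Base using ([]; _∷_; tabulate)
open import Data.Vec.Properties using (lookup∘tabulate; lookup⇒[]=; []=⇒lookup; tabulate-cong)
open import Function.Base using (_∘_; const)
open import Function.Bundles using (_↔_; module Inverse; module Injection)
open import Function.Construct.Composition using (_↔-∘_)
open import Function.Construct.Identity using (↔-id)
open import Function.Properties.Inverse using (↔⇒↣)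
open import Level using (0ℓ)
open import Relation.Binary.PropositionalEquality
  using (_≡_; _≢_; refl; sym; trans; cong; cong₂; subst; subst₂; module ≡-Reasoning)
open import Relation.Nullary using (¬_; Dec; yes; no; does; contradiction; ¬?; _×-dec_)
open import Relation.Nullary.Decidable using (dec-true; dec-false; decidable-stable)
open import Relation.Unary using (Pred; Decidable)
open import Algebra.Properties.CommutativeMonoid.Sum +-0-commutativeMonoid
  using (sum; ∑-distrib-+; sum-cong-≗; sum-replicate-zero)

-- Counting with Boolean predicates on finite sets.

card : ∀ {n} → (Fin n → Bool) → ℕ
card b = ∣ tabulate b ∣

card-true : ∀ n → card {n} (const true) ≡ n
card-true zero    = refl
card-true (suc n) = cong suc (card-true n)

card-false : ∀ n → card {n} (const false) ≡ 0
card-false zero    = refl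
card-false (suc n) = card-false n

card-cong : ∀ {n} {f g : Fin n → Bool} → (∀ i → f i ≡ g i) → card f ≡ card g
card-cong f≗g = cong ∣_∣ (tabulate-cong f≗g)

card-splitAt : ∀ a {c} (f : Fin a ⊎ Fin c → Bool) →
               card (f ∘ splitAt a) ≡ card (f ∘ inj₁) + card (f ∘ inj₂)
card-splitAt zero    f = refl
card-splitAt (suc a) f with f (inj₁ zero)
... | true  = cong suc (card-splitAt a (f ∘ Sum.map₁ suc))
... | false = card-splitAt a (f ∘ Sum.map₁ suc)

-- Induction on the number of rows: the first row contributes `card g` or nothing, according to
-- `f zero`.
card-remQuot : ∀ {a} c (f : Fin a → Bool) (g : Fin c → Bool) →
               card (uncurry (λ i j → f i ∧ g j) ∘ remQuot {a} c) ≡ card f * card g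
card-remQuot {zero}  c f g = refl
card-remQuot {suc a} c f g =
  trans (card-splitAt c (uncurry (λ j i → f i ∧ g j) ∘
                         [ (_, zero) , Product.map₂ suc ∘ quotRem {a} c ]′))
        split
  where
  split : card (λ j → f zero ∧ g j) + card (uncurry (λ i j → f (suc i) ∧ g j) ∘ remQuot {a} c)
        ≡ card f * card g
  split with f zero
  ... | true  = cong (card g +_) (card-remQuot c (f ∘ suc) g)
  ... | false = cong₂ _+_ (card-false c) (card-remQuot c (f ∘ suc) g)

card-≡ : ∀ {n} (i : Fin n) → card (λ j → does (i ≟ j)) ≡ 1
card-≡ {suc n} zero    = cong suc (card-false n)
card-≡ {suc n} (suc i) = card-≡ i

card-≢ : ∀ {n} (i : Fin (suc n)) → card (λ j → not (does (i ≟ j))) ≡ n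
card-≢ {n}     zero    = card-true n
card-≢ {suc n} (suc i) = cong suc (card-≢ i)

card-∈ : ∀ {n} (p : Subset n) → card (λ x → does (x ∈? p)) ≡ ∣ p ∣
card-∈ [] = refl
card-∈ (inside  ∷ p) = cong suc (card-∈ p)
card-∈ (outside ∷ p) = card-∈ p

-- Decidable subsets and the number of colours in an image.

∈-tabulate⁺ : ∀ {n} {P : Pred (Fin n) 0ℓ} (P? : Decidable P) {i} → P i → i ∈ tabulate (does ∘ P?)
∈-tabulate⁺ P? {i} Pi = lookup⇒[]= i _ (trans (lookup∘tabulate _ i) (dec-true (P? i) Pi))

∈-tabulate⁻ : ∀ {n} {P : Pred (Fin n) 0ℓ} (P? : Decidable P) {i} → i ∈ tabulate (does ∘ P?) → P i
∈-tabulate⁻ P? {i} i∈ with P? i | trans (sym (lookup∘tabulate (does ∘ P?) i)) ([]=⇒lookup i∈)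
... | yes Pi | _ = Pi

2≤∣p∣ : ∀ {n} {p : Subset n} {x y} → x ∈ p → y ∈ p → x ≢ y → 2 ≤ ∣ p ∣
2≤∣p∣ x∈p y∈p x≢y =
  ≤-trans (s≤s (≤-trans (s≤s z≤n) (x∈p⇒∣p-x∣<∣p∣ (x∈p∧x≢y⇒x∈p-y y∈p (x≢y ∘ sym)))))
          (x∈p⇒∣p-x∣<∣p∣ x∈p)

image-nonconstant : ∀ {m k} (c : Fin m → Fin k) {p : Subset m} {u v} →
                    u ∈ p → v ∈ p → c u ≢ c v → 2 ≤ ∣ image c p ∣
image-nonconstant c {p} u∈p v∈p cu≢cv = 2≤∣p∣ (c∈ u∈p) (c∈ v∈p) cu≢cv
  where
  c∈ : ∀ {u} → u ∈ p → c u ∈ image c p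
  c∈ {u} u∈p = ∈-tabulate⁺ (λ a → any? (λ w → (w ∈? p) ×-dec (c w ≟ a))) (u , u∈p , refl)

image-constant : ∀ {m k} (c : Fin m → Fin k) {p : Subset m} a →
                 (∀ {u} → u ∈ p → c u ≡ a) → ∣ image c p ∣ ≤ 1
image-constant c {p} a c≡a = subst (∣ image c p ∣ ≤_) (∣⁅x⁆∣≡1 a) (p⊆q⇒∣p∣≤∣q∣ image⊆)
  where
  image⊆ : image c p ⊆ ⁅ a ⁆
  image⊆ b∈ with ∈-tabulate⁻ (λ b → any? (λ w → (w ∈? p) ×-dec (c w ≟ b))) b∈
  ... | u , u∈p , refl = subst (_∈ ⁅ a ⁆) (sym (c≡a u∈p)) (x∈⁅x⁆ a)

-- Fibres and the pigeonhole principle.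

indicator : Bool → ℕ
indicator b = if b then 1 else 0

card≡sum : ∀ {n} (b : Fin n → Bool) → card b ≡ sum (indicator ∘ b)
card≡sum {zero}  b = refl
card≡sum {suc n} b with b zero
... | true  = cong suc (card≡sum (b ∘ suc))
... | false = card≡sum (b ∘ suc)

fibre : ∀ {m n} → (Fin m → Fin n) → Fin n → Subset m
fibre f y = tabulate (λ x → does (f x ≟ y))

-- Each point lies in exactly one fibre, so prepending a point raises the sum by one.
sum-fibres : ∀ {m n} (f : Fin m → Fin n) → sum (∣_∣ ∘ fibre f) ≡ m
sum-fibres {zero}  {n} f = sum-replicate-zero n
sum-fibres {suc m} {n} f = begin
  sum (∣_∣ ∘ fibre f)
    ≡⟨ sum-cong-≗ (λ y → head (does (f zero ≟ y)) (fibre (f ∘ suc) y)) ⟩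
  sum (λ y → indicator (does (f zero ≟ y)) + ∣ fibre (f ∘ suc) y ∣)
    ≡⟨ ∑-distrib-+ (λ y → indicator (does (f zero ≟ y))) (∣_∣ ∘ fibre (f ∘ suc)) ⟩
  sum (λ y → indicator (does (f zero ≟ y))) + sum (∣_∣ ∘ fibre (f ∘ suc))
    ≡⟨ cong₂ _+_ (trans (sym (card≡sum (λ y → does (f zero ≟ y)))) (card-≡ (f zero)))
                 (sum-fibres (f ∘ suc)) ⟩
  suc m ∎
  where
  open ≡-Reasoning
  head : ∀ b (p : Subset m) → ∣ b ∷ p ∣ ≡ indicator b + ∣ p ∣
  head true  p = refl
  head false p = refl

sum-≤ : ∀ {n} k (f : Fin n → ℕ) → (∀ i → f i ≤ k) → sum f ≤ n * k
sum-≤ {zero}  k f f≤k = z≤n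
sum-≤ {suc n} k f f≤k = +-mono-≤ (f≤k zero) (sum-≤ k (f ∘ suc) (f≤k ∘ suc))

large-fibre : ∀ {m n} k (f : Fin m → Fin n) → n * k < m → ∃ λ y → k < ∣ fibre f y ∣
large-fibre {m} {n} k f nk<m with any? (λ y → k <? ∣ fibre f y ∣)
... | yes large = large
... | no ¬large = contradiction nk<m (≤⇒≯ (subst (_≤ n * k) (sum-fibres f)
                    (sum-≤ k (∣_∣ ∘ fibre f) (λ y → ≮⇒≥ (λ k< → ¬large (y , k<))))))

-- Enumeration of the subsets of a given size.

-- Pascal's recursion rather than the library's _C_, so that indices below it split by computation.
infix 8 _choose_
_choose_ : ℕ → ℕ → ℕ
_     choose zero  = 1
zero  choose suc q = 0
suc m choose suc q = m choose q + m choose suc q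

choose>0 : ∀ {m q} → q ≤ m → 0 < m choose q
choose>0 {m} {zero} _ = s≤s z≤n
choose>0 {suc m} {suc q} (s≤s q≤m) = ≤-trans (choose>0 q≤m) (m≤m+n _ _)

-- Both summands of Pascal's recursion are positive. This later puts at least two vertices in each
-- part.
choose>1 : ∀ {m q} → q < m → 1 < suc m choose suc q
choose>1 q<m = +-mono-≤ (choose>0 (<⇒≤ q<m)) (choose>0 q<m)

-- The two summands of Pascal's recursion index the subsets with and without the first element.
subset : ∀ m q → Fin (m choose q) → Subset m
subset m       zero    _ = ⊥
subset (suc m) (suc q) t =
  [ (inside ∷_) ∘ subset m q , (outside ∷_) ∘ subset m (suc q) ]′ (splitAt (m choose q) t)

∣subset∣≡ : ∀ m q t → ∣ subset m q t ∣ ≡ q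
∣subset∣≡ m       zero    t = ∣⊥∣≡0 m
∣subset∣≡ (suc m) (suc q) t with splitAt (m choose q) t
... | inj₁ t′ = cong suc (∣subset∣≡ m q t′)
... | inj₂ t′ = ∣subset∣≡ m (suc q) t′

-- The choice is greedy: the first `q` elements of `p` form the required subset.
subset-⊆ : ∀ {m} q (p : Subset m) → q ≤ ∣ p ∣ → ∃ λ t → subset m q t ⊆ p
subset-⊆ zero    p             _         = zero , λ x∈⊥ → contradiction x∈⊥ ∉⊥
subset-⊆ {suc m} (suc q) (inside ∷ p)  (s≤s q≤) with t , t⊆p ← subset-⊆ q p q≤ =
  t ↑ˡ (m choose suc q) , inj₁-⊆
  where
  inj₁-⊆ : subset (suc m) (suc q) (t ↑ˡ (m choose suc q)) ⊆ inside ∷ p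
  inj₁-⊆ rewrite splitAt-↑ˡ (m choose q) t (m choose suc q) = s⊆s t⊆p
subset-⊆ {suc m} (suc q) (outside ∷ p) q≤ with t , t⊆p ← subset-⊆ (suc q) p q≤ =
  (m choose q) ↑ʳ t , inj₂-⊆
  where
  inj₂-⊆ : subset (suc m) (suc q) ((m choose q) ↑ʳ t) ⊆ outside ∷ p
  inj₂-⊆ rewrite splitAt-↑ʳ (m choose q) (m choose suc q) t = s⊆s t⊆p

-- The count does not depend on `x`, which makes all core vertices have equally many probes. For `x`
-- other than the first element, both halves of the enumeration are counted inductively and Pascal's
-- recursion adds them up.
card-subset∋ : ∀ m q (x : Fin (suc m)) →
               card (λ t → does (x ∈? subset (suc m) (suc q) t)) ≡ m choose q
card-subset∋ m q x = trans (card-splitAt (m choose q) (λ t → does (x ∈?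
    [ (inside ∷_) ∘ subset m q , (outside ∷_) ∘ subset m (suc q) ]′ t))) (split m q x)
  where
  split : ∀ m q (x : Fin (suc m)) →
          card (λ t → does (x ∈? (inside ∷ subset m q t))) +
          card (λ t → does (x ∈? (outside ∷ subset m (suc q) t))) ≡ m choose q
  split m q zero =
    trans (cong₂ _+_ (card-true (m choose q)) (card-false (m choose suc q))) (+-identityʳ _)
  split (suc m) zero    (suc x) =
    cong₂ _+_ (card-cong {1} (λ _ → dec-false (x ∈? ⊥) ∉⊥)) (card-subset∋ m zero x)
  split (suc m) (suc q) (suc x) = cong₂ _+_ (card-subset∋ m q x) (card-subset∋ m (suc q) x)

-- The graph, for an arbitrary uniform family of sets of copies.

module Construction
  (k l : ℕ) {M T : ℕ} (S : Fin T → Subset M)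
  (∣S∣≡ : ∀ t → ∣ S t ∣ ≡ 2 + k)
  (card-S∋ : ∀ s → card (λ t → does (s ∈? S t)) ≡ 2 + l)
  where

  n m d : ℕ
  n = 2 + k
  m = 2 + l
  d = n * m

  V : Set
  V = (Fin M × Fin n × Fin m) ⊎ (Fin n × Fin T)

  pattern core s i x = inj₁ (s , i , x)
  pattern probe i t = inj₂ (i , t)

  infix 4 _—_ _—?_

  -- The conjuncts follow the order of the coordinates of the second vertex, so that `does` of the
  -- decision procedure unfolds to the products counted by `card-remQuot`.
  _—_ : V → V → Set
  core s i x — core s′ i′ x′ = s ≡ s′ × ¬ i ≡ i′
  core s i x — probe i′ t    = i ≡ i′ × s ∈ S t
  probe i t  — core s i′ x   = s ∈ S t × i ≡ i′
  probe i t  — probe i′ t′   = Empty.⊥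

  _—?_ : ∀ u v → Dec (u — v)
  core s i x —? core s′ i′ x′ = (s ≟ s′) ×-dec ¬? (i ≟ i′)
  core s i x —? probe i′ t    = (i ≟ i′) ×-dec (s ∈? S t)
  probe i t  —? core s i′ x   = (s ∈? S t) ×-dec (i ≟ i′)
  probe i t  —? probe i′ t′   = no λ ()

  —-sym : ∀ u v → u — v → v — u
  —-sym (core s i x) (core s′ i′ x′) (s≡s′ , i≢i′) = sym s≡s′ , i≢i′ ∘ sym
  —-sym (core s i x) (probe i′ t)    (i≡i′ , s∈S)  = s∈S , sym i≡i′
  —-sym (probe i t)  (core s i′ x)   (s∈S , i≡i′)  = sym i≡i′ , s∈S

  —-irrefl : ∀ v → ¬ v — v
  —-irrefl (core s i x) (_ , i≢i) = i≢i refl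

  coreVertices : Fin (M * (n * m)) ↔ (Fin M × Fin n × Fin m)
  coreVertices = (↔-id (Fin M) ×-↔ *↔×) ↔-∘ *↔×

  vertices : Fin (M * (n * m) + n * T) ↔ V
  vertices = (coreVertices ⊎-↔ *↔×) ↔-∘ +↔⊎

  open Inverse vertices using ()
    renaming (to to decode; from to encode;
              strictlyInverseˡ to decode∘encode; strictlyInverseʳ to encode∘decode)

  G : Graph
  G = record
    { order    = M * (n * m) + n * T
    ; _~_      = λ u v → decode u — decode v
    ; _~?_     = λ u v → decode u —? decode v
    ; ~-sym    = λ {u} {v} → —-sym (decode u) (decode v)
    ; ~-irrefl = λ { {u} refl → —-irrefl (decode u) }
    }

  open Graph G using (_~_; _~?_; neighbourhood)

  -- Regularity.

  card-core : (f : Fin M → Bool) (g : Fin n → Bool) →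
              card (uncurry (λ s j → f s ∧ g (quotient {n} m j)) ∘ remQuot {M} (n * m))
              ≡ card f * (card g * m)
  card-core f g = begin
    card (uncurry (λ s j → f s ∧ g (quotient {n} m j)) ∘ remQuot {M} (n * m))
      ≡⟨ card-remQuot (n * m) f (g ∘ quotient {n} m) ⟩
    card f * card (g ∘ quotient {n} m)
      -- The position inside a part is unconstrained; the factor `true` makes this a product over
      -- index and position.
      ≡⟨ cong (card f *_) (card-cong (λ j → sym (∧-identityʳ (g (quotient {n} m j))))) ⟩
    card f * card (uncurry (λ i x → g i ∧ true) ∘ remQuot {n} m)
      ≡⟨ cong (card f *_) (card-remQuot m g (const true)) ⟩
    card f * (card g * card {m} (const true))
      ≡⟨ cong (λ c → card f * (card g * c)) (card-true m) ⟩
    card f * (card g * m) ∎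
    where open ≡-Reasoning

  -- A core vertex has `(1 + k) * m` neighbours in its own copy and `m` probes; a probe has `m`
  -- neighbours in each of `n` copies.
  card-neighbours : ∀ v → card (λ u → does (v —? decode u)) ≡ d
  card-neighbours (core s i x) = begin
    card (λ u → does (core s i x —? decode u))
      ≡⟨ card-splitAt (M * (n * m))
           (λ u → does (core s i x —? Sum.map (Inverse.to coreVertices) (remQuot T) u)) ⟩
    _ ≡⟨ cong₂ _+_ (card-core (λ s′ → does (s ≟ s′)) (λ i′ → not (does (i ≟ i′))))
                   (card-remQuot T (λ i′ → does (i ≟ i′)) (λ t → does (s ∈? S t))) ⟩
    _ ≡⟨ cong₂ _+_ (cong₂ (λ a b → a * (b * m)) (card-≡ s) (card-≢ i))
                   (cong₂ _*_ (card-≡ i) (card-S∋ s)) ⟩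
    1 * ((1 + k) * m) + 1 * m
      ≡⟨ cong₂ _+_ (*-identityˡ ((1 + k) * m)) (*-identityˡ m) ⟩
    (1 + k) * m + m
      ≡⟨ +-comm ((1 + k) * m) m ⟩
    d ∎
    where open ≡-Reasoning
  card-neighbours (probe i t) = begin
    card (λ u → does (probe i t —? decode u))
      ≡⟨ card-splitAt (M * (n * m))
           (λ u → does (probe i t —? Sum.map (Inverse.to coreVertices) (remQuot T) u)) ⟩
    _ ≡⟨ cong₂ _+_ (card-core (λ s → does (s ∈? S t)) (λ i′ → does (i ≟ i′)))
                   (card-false (n * T)) ⟩
    _ ≡⟨ +-identityʳ _ ⟩
    _ ≡⟨ cong₂ (λ a b → a * (b * m)) (trans (card-∈ (S t)) (∣S∣≡ t)) (card-≡ i) ⟩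
    n * (1 * m)
      ≡⟨ cong (n *_) (*-identityˡ m) ⟩
    d ∎
    where open ≡-Reasoning

  regular : Regular G
  regular = d , card-neighbours ∘ decode

  -- Adjacency through the encoding, and the explicit colourings.

  parts-joined : ∀ s {i i′} x x′ → i ≢ i′ → encode (core s i x) ~ encode (core s i′ x′)
  parts-joined s {i} {i′} x x′ i≢i′ =
    subst₂ _—_ (sym (decode∘encode (core s i x))) (sym (decode∘encode (core s i′ x′))) (refl , i≢i′)

  encode-neighbour : ∀ {v u} → decode v — u → encode u ∈ neighbourhood v
  encode-neighbour {v} {u} v—u =
    ∈-tabulate⁺ (v ~?_) (subst (decode v —_) (sym (decode∘encode u)) v—u)

  other : Fin n → Fin n
  other zero    = suc zero
  other (suc _) = zero

  i≢other : ∀ i → i ≢ other i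
  i≢other zero    ()
  i≢other (suc i) ()

  part : V → Fin n
  part (core s i x) = i
  part (probe i t)  = other i

  part-proper : ∀ u v → u — v → part u ≢ part v
  part-proper (core s i x) (core s′ i′ x′) (_ , i≢i′)   = i≢i′
  part-proper (core s i x) (probe _ t)     (refl , _)   = i≢other i
  part-proper (probe i t)  (core s _ x)    (_ , refl)   = i≢other i ∘ sym

  colourable : Colourable G n
  colourable = part ∘ decode , λ {u} {v} → part-proper (decode u) (decode v)

  -- Selects one of the two colours reserved for a part index. Both occur in every part of a copy,
  -- as `m` is at least 2; the value at probes is a default.
  half : V → Fin 2
  half (core s i zero)    = zero
  half (core s i (suc _)) = suc zero
  half (probe i t)        = zero

  dynamicColourable : DynamicColourable 2 G (2 * n)
  dynamicColourable = c ∘ decode , proper , λ v → ≤-trans (m⊓n≤m 2 _) (dynamic v)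
    where
    c : V → Fin (2 * n)
    c v = combine (half v) (part v)

    proper : IsProper G (c ∘ decode)
    proper {u} {v} u—v eq = part-proper (decode u) (decode v) u—v
      (combine-injectiveʳ (half (decode u)) (part (decode u))
                          (half (decode v)) (part (decode v)) eq)

    two-halves : ∀ {v u w} → decode v — u → decode v — w → half u ≢ half w →
                 2 ≤ ∣ image (c ∘ decode) (neighbourhood v) ∣
    two-halves {v} {u} {w} v—u v—w u≢w =
      image-nonconstant (c ∘ decode) (encode-neighbour {v} v—u) (encode-neighbour {v} v—w)
        (λ eq → u≢w (combine-injectiveˡ (half u) (part u) (half w) (part w)
          (trans (cong c (sym (decode∘encode u))) (trans eq (cong c (decode∘encode w))))))

    -- Every vertex is joined to an entire part of some copy, where both halves occur.
    neighbours : ∀ v → ∃₂ λ s i → ∀ x → v — core s i x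
    neighbours (core s i x) = s , other i , λ _ → refl , i≢other i
    neighbours (probe i t) with nonempty? (S t)
    ... | yes (s , s∈S) = s , i , λ _ → s∈S , refl
    ... | no empty =
      contradiction (trans (sym (∣S∣≡ t)) (trans (cong ∣_∣ (Empty-unique empty)) (∣⊥∣≡0 M))) λ ()

    dynamic : ∀ v → 2 ≤ ∣ image (c ∘ decode) (neighbourhood v) ∣
    dynamic v with s , i , v—core ← neighbours (decode v) =
      two-halves {v} (v—core zero) (v—core (suc zero)) λ ()

  -- Lower bounds.

  χ-lower : Fin M → ∀ j → Colourable G j → n ≤ j
  -- One vertex from each part of the copy `s` gives a clique of size `n`.
  χ-lower s j (c , proper) = injective⇒≤ {f = λ i → c (encode (core s i zero))} inj
    where
    inj : ∀ {i i′} → c (encode (core s i zero)) ≡ c (encode (core s i′ zero)) → i ≡ i′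
    inj {i} {i′} eq = decidable-stable (i ≟ i′) (λ i≢i′ → proper (parts-joined s zero zero i≢i′) eq)

  -- Otherwise two distinct colours from each part make 2n distinct colours, as the parts are
  -- pairwise fully joined.
  monochromatic-part : ∀ {j} (c : Colouring G j) → IsProper G c → j < 2 * n →
                       ∀ s → ∃₂ λ i a → ∀ x → c (encode (core s i x)) ≡ a
  monochromatic-part {j} c proper j<2n s
    with any? (λ i → all? (λ x → c (encode (core s i x)) ≟ c (encode (core s i zero))))
  ... | yes (i , mono) = i , c (encode (core s i zero)) , mono
  ... | no ¬mono = contradiction j<2n (≤⇒≯ (injective⇒≤ {f = λ p → colour (remQuot {2} n p)}
                     (λ eq → Injection.injective (↔⇒↣ (*↔× {2} {n})) (colour-injective _ _ eq))))
    where
    distinct : ∀ i → ∃ λ x → c (encode (core s i x)) ≢ c (encode (core s i zero))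
    distinct i = ¬∀⟶∃¬ m _ (λ x → c (encode (core s i x)) ≟ c (encode (core s i zero)))
                   (λ mono → ¬mono (i , mono))

    choice : Fin 2 → Fin n → Fin m
    choice zero       i = zero
    choice (suc zero) i = proj₁ (distinct i)

    colour : Fin 2 × Fin n → Fin j
    colour (b , i) = c (encode (core s i (choice b i)))

    same-part : ∀ b b′ i → colour (b , i) ≡ colour (b′ , i) → b ≡ b′
    same-part zero       zero       i eq = refl
    same-part zero       (suc zero) i eq = contradiction (sym eq) (proj₂ (distinct i))
    same-part (suc zero) zero       i eq = contradiction eq (proj₂ (distinct i))
    same-part (suc zero) (suc zero) i eq = refl

    colour-injective : ∀ p q → colour p ≡ colour q → p ≡ q
    colour-injective (b , i) (b′ , i′) eq with i ≟ i′
    ... | yes refl = cong (_, i) (same-part b b′ i eq)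
    ... | no i≢i′  = contradiction eq (proper (parts-joined s (choice b i) (choice b′ i′) i≢i′))

  χ₂-lower : (∀ {C} → C ≤ n * (2 * n) → (f : Fin M → Fin C) →
              ∃₂ λ t z → ∀ {s} → s ∈ S t → f s ≡ z) →
             ∀ j → DynamicColourable 2 G j → 2 * n ≤ j
  χ₂-lower ramsey j (c , proper , dynamic) = ≮⇒≥ λ j<2n → let
      mono = monochromatic-part c proper j<2n
      -- Each copy is labelled by the index and colour of a monochromatic part, packed into one
      -- element of `Fin (n * j)`; `i` and `a` below unpack the common label.
      t , z , f≡z = ramsey (*-monoʳ-≤ n (<⇒≤ j<2n))
                      (λ s → combine (proj₁ (mono s)) (proj₁ (proj₂ (mono s))))
      i , a = remQuot {n} j z
    in ≤⇒≯ (probe-constant i t a λ {s} s∈S x → let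
         i≡ , a≡ = combine-injective (proj₁ (mono s)) (proj₁ (proj₂ (mono s))) i a
                     (trans (f≡z s∈S) (sym (combine-remQuot {n} j z)))
       in trans (cong (λ i → c (encode (core s i x))) (sym i≡))
                (trans (proj₂ (proj₂ (mono s)) x) a≡))
       -- With the degree rewritten to `d`, the bound `2 ⊓ d` computes to 2, so the probe needs two
       -- colours around it.
       (subst (λ e → 2 ⊓ e ≤ ∣ image c (neighbourhood (encode (probe i t))) ∣)
         (proj₂ regular (encode (probe i t))) (dynamic (encode (probe i t))))
    where
    probe-constant : ∀ i t a → (∀ {s} → s ∈ S t → ∀ x → c (encode (core s i x)) ≡ a) →
                     ∣ image c (neighbourhood (encode (probe i t))) ∣ ≤ 1
    probe-constant i t a mono = image-constant c a λ {u} u∈ →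
      trans (cong c (sym (encode∘decode u)))
        (neighbour (decode u) (subst (_— decode u) (decode∘encode (probe i t))
          (∈-tabulate⁻ (encode (probe i t) ~?_) u∈)))
      where
      neighbour : ∀ u → probe i t — u → c (encode u) ≡ a
      neighbour (core s i x) (s∈S , refl) = mono s∈S x

-- Choice of the parameters.

theorem1p2 : ∀ (n : ℕ) → n ≥ 2 →
    ∃ λ (G : Graph) →
    Regular G × HasChromaticNumber G n × HasDynamicChromaticNumber 2 G (2 * n)
theorem1p2 (suc zero) (s≤s ())
theorem1p2 (suc (suc k)) _ =
  G , regular , (colourable , χ-lower zero) , (dynamicColourable , χ₂-lower ramsey)
  where
  -- N * (2 * N) bounds the number of pairs (part, colour); the graph uses suc L copies.
  N L : ℕ
  N = 2 + k
  L = N * (2 * N) * N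

  N≤L : N ≤ L
  N≤L = m≤n*m N (N * (2 * N))

  -- A copy lies in `L choose (1 + k)` of the `N`-subsets of the copies. This is the part size
  -- `2 + l`; it is at least 2, so the truncated subtraction is exact.
  l : ℕ
  l = L choose (1 + k) ∸ 2

  l≡ : L choose (1 + k) ≡ 2 + l
  l≡ = sym (m+[n∸m]≡n (choose>1 (s≤s⁻¹ N≤L)))

  open Construction k l (subset (suc L) N) (∣subset∣≡ (suc L) N)
    (λ s → trans (card-subset∋ L (1 + k) s) l≡)

  ramsey : ∀ {C} → C ≤ N * (2 * N) → (f : Fin (suc L) → Fin C) →
           ∃₂ λ t z → ∀ {s} → s ∈ subset (suc L) N t → f s ≡ z
  ramsey {C} C≤ f = let
      -- As `C * N` is at most `L`, the `suc L` copies force a fibre with more than `N` elements,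
      -- which contains one of the enumerated `N`-subsets.
      z , large = large-fibre N f (s≤s (*-monoˡ-≤ N C≤))
      t , t⊆    = subset-⊆ N (fibre f z) (<⇒≤ large)
    in t , z , λ s∈ → ∈-tabulate⁻ (λ s → f s ≟ z) (t⊆ s∈)
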